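{- $A(n,d)\le r$ if and only if there exist $n$ points $v_1,\ldots,v_n$ in $\mathbb{C}^r$ such that the linear span of any $d-1$ of them is contained in $\mathbf{V}\left(\sum_{i=1}^rx_i^d\right)$, but the linear span of any $d$ of them is not (i.e. for every choice of $d$ of the points, their span is not contained in this hypersurface).
   Context: $\mathbf{V}(f)=\{p\in\mathbb{C}^r:f(p)=0\}$. For a homogeneous $g\in\mathbb{C}[x_1,\ldots,x_n]_d$, the Waring rank $\mathbf{R}(g)$ is the minimum $s$ such that $g=\ell_1^d+\cdots+\ell_s^d$ for some complex linear forms $\ell_i$. $A(n,d)$ is the minimum of $\mathbf{R}(g)$ over all $g\in\mathbb{C}[x_1,\ldots,x_n]_d$ whose set of monomials with nonzero coefficient is exactly the set of all multilinear monomials $x_{i_1}\cdots x_{i_d}$, $1\le i_1<\cdots<i_d\le n$. -}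

module Defs where

open import Algebra.Bundles using (CommutativeRing; RawSemiring; Semiring)
import Algebra.Definitions.RawSemiring as RawSemiringDefinitions
open import Algebra.Structures using (IsCommutativeRing)
open import Data.Bool.Base using (if_then_else_)
open import Data.Fin.Base using (Fin)
open import Data.Fin.Subset using (Subset; _∉_; ∣_∣)
open import Data.List.Base using (List; []; _∷_; _++_; foldr; cartesianProductWith)
open import Data.Nat.Base as ℕ using (ℕ)
import Data.Nat.Properties as ℕₚ
open import Data.Product.Base using (∃-syntax; Σ-syntax; _×_; _,_; proj₁; proj₂)
open import Data.Rational.Base as ℚ using (ℚ; 0ℚ; 1ℚ; ½)
import Data.Rational.Properties as ℚₚ
open import Data.Rational.Solver using (module +-*-Solver)
open import Data.Vec.Base as Vec using (Vec)
open import Data.Vec.Functional using (Vector)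
open import Data.Vec.Properties using (≡-dec)
open import Level using (0ℓ)
open import Relation.Binary.Bundles using (Setoid)
open import Relation.Binary.PropositionalEquality as ≡ using (_≡_; refl; cong; subst)
open import Relation.Binary.Structures using (IsEquivalence)
open import Relation.Nullary using (¬_; does)
open import Relation.Unary using (Pred; _∈_; _≐_)

module Real where

  -- The existential is a Σ-type, so a Cauchy sequence carries a modulus.
  IsCauchy : (ℕ → ℚ) → Set
  IsCauchy x = ∀ ε → 0ℚ ℚ.< ε →
    ∃[ N ] (∀ m n → N ℕ.≤ m → N ℕ.≤ n → ℚ.∣ x m ℚ.- x n ∣ ℚ.< ε)

  record ℝ : Set where
    constructor mkℝ
    field
      seq    : ℕ → ℚ
      cauchy : IsCauchy seq

  open ℝ public

  infix 4 _≈_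

  _≈_ : ℝ → ℝ → Set
  x ≈ y = ∀ ε → 0ℚ ℚ.< ε →
    ∃[ N ] (∀ n → N ℕ.≤ n → ℚ.∣ seq x n ℚ.- seq y n ∣ ℚ.< ε)

  private
    half : ∀ {ε} → 0ℚ ℚ.< ε → 0ℚ ℚ.< ε ℚ.* ½
    half {ε} 0<ε = subst (ℚ._< ε ℚ.* ½) (ℚₚ.*-zeroˡ ½) (ℚₚ.*-monoˡ-<-pos ½ 0<ε)

    half+half : ∀ ε → ε ℚ.* ½ ℚ.+ ε ℚ.* ½ ≡ ε
    half+half ε = ≡.trans (≡.sym (ℚₚ.*-distribˡ-+ ε ½ ½)) (ℚₚ.*-identityʳ ε)

    +-small : ∀ {ε} p q → ℚ.∣ p ∣ ℚ.< ε ℚ.* ½ → ℚ.∣ q ∣ ℚ.< ε ℚ.* ½ → ℚ.∣ p ℚ.+ q ∣ ℚ.< ε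
    +-small {ε} p q p< q< = subst (ℚ.∣ p ℚ.+ q ∣ ℚ.<_) (half+half ε)
      (ℚₚ.≤-<-trans (ℚₚ.∣p+q∣≤∣p∣+∣q∣ p q) (ℚₚ.+-mono-< p< q<))

    ∣-∣-swap : ∀ p q → ℚ.∣ p ℚ.- q ∣ ≡ ℚ.∣ q ℚ.- p ∣
    ∣-∣-swap p q = ≡.trans (cong ℚ.∣_∣ (lemma p q)) (ℚₚ.∣-p∣≡∣p∣ (q ℚ.- p))
      where
      open +-*-Solver
      lemma : ∀ p q → p ℚ.- q ≡ ℚ.- (q ℚ.- p)
      lemma = solve 2 (λ p q → p :- q := :- (q :- p)) refl

    ∣p-p∣<ε : ∀ p {ε} → 0ℚ ℚ.< ε → ℚ.∣ p ℚ.- p ∣ ℚ.< ε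
    ∣p-p∣<ε p {ε} 0<ε = subst (λ z → ℚ.∣ z ∣ ℚ.< ε) (≡.sym (ℚₚ.+-inverseʳ p)) 0<ε

    div : ℚ → ∀ B → 0ℚ ℚ.< B → ℚ
    div ε B 0<B = ε ℚ.* (ℚ.1/ B) {{ℚₚ.pos⇒nonZero B {{ℚ.positive 0<B}}}}

    0<div : ∀ {ε B} → 0ℚ ℚ.< ε → (0<B : 0ℚ ℚ.< B) → 0ℚ ℚ.< div ε B 0<B
    0<div {ε} {B} 0<ε 0<B = subst (ℚ._< div ε B 0<B) (ℚₚ.*-zeroˡ i) (ℚₚ.*-monoˡ-<-pos i 0<ε)
      where
      instance
        B-pos : ℚ.Positive B
        B-pos = ℚ.positive 0<B
      i : ℚ
      i = (ℚ.1/ B) {{ℚₚ.pos⇒nonZero B}}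
      instance
        i-pos : ℚ.Positive i
        i-pos = ℚₚ.1/pos⇒pos B

    *-small : ∀ {δ B} (0<B : 0ℚ ℚ.< B) p q →
              ℚ.∣ p ∣ ℚ.≤ B → ℚ.∣ q ∣ ℚ.< div δ B 0<B → ℚ.∣ p ℚ.* q ∣ ℚ.< δ
    *-small {δ} {B} 0<B p q p≤B q< = begin-strict
      ℚ.∣ p ℚ.* q ∣         ≡⟨ ℚₚ.∣p*q∣≡∣p∣*∣q∣ p q ⟩
      ℚ.∣ p ∣ ℚ.* ℚ.∣ q ∣   ≤⟨ ℚₚ.*-monoʳ-≤-nonNeg ℚ.∣ q ∣ {{ℚₚ.∣-∣-nonNeg q}} p≤B ⟩
      B ℚ.* ℚ.∣ q ∣         <⟨ ℚₚ.*-monoʳ-<-pos B q< ⟩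
      B ℚ.* (δ ℚ.* i)       ≡⟨ cong (B ℚ.*_) (ℚₚ.*-comm δ i) ⟩
      B ℚ.* (i ℚ.* δ)       ≡⟨ ℚₚ.*-assoc B i δ ⟨
      (B ℚ.* i) ℚ.* δ       ≡⟨ cong (ℚ._* δ) (ℚₚ.*-inverseʳ B {{ℚₚ.pos⇒nonZero B}}) ⟩
      1ℚ ℚ.* δ              ≡⟨ ℚₚ.*-identityˡ δ ⟩
      δ ∎
      where
      open ℚₚ.≤-Reasoning
      instance
        B-pos : ℚ.Positive B
        B-pos = ℚ.positive 0<B
      i : ℚ
      i = (ℚ.1/ B) {{ℚₚ.pos⇒nonZero B}}

    bound : ∀ x → IsCauchy x → ∃[ B ] (0ℚ ℚ.< B × ∃[ N ] (∀ n → N ℕ.≤ n → ℚ.∣ x n ∣ ℚ.≤ B))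
    bound x cx with N , h ← cx 1ℚ (ℚₚ.positive⁻¹ 1ℚ) =
      ℚ.∣ x N ∣ ℚ.+ 1ℚ
      , ℚₚ.+-mono-≤-< (ℚₚ.0≤∣p∣ (x N)) (ℚₚ.positive⁻¹ 1ℚ)
      , N
      , λ n N≤n → begin
          ℚ.∣ x n ∣                          ≡⟨ cong ℚ.∣_∣ (lemma (x n) (x N)) ⟩
          ℚ.∣ x N ℚ.+ (x n ℚ.- x N) ∣        ≤⟨ ℚₚ.∣p+q∣≤∣p∣+∣q∣ (x N) (x n ℚ.- x N) ⟩
          ℚ.∣ x N ∣ ℚ.+ ℚ.∣ x n ℚ.- x N ∣    ≤⟨ ℚₚ.+-monoʳ-≤ ℚ.∣ x N ∣ (ℚₚ.<⇒≤ (h n N N≤n ℕₚ.≤-refl)) ⟩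
          ℚ.∣ x N ∣ ℚ.+ 1ℚ                   ∎
      where
      open ℚₚ.≤-Reasoning
      open +-*-Solver
      lemma : ∀ p q → p ≡ q ℚ.+ (p ℚ.- q)
      lemma = solve 2 (λ p q → p := q :+ (p :- q)) refl

    split-+ : ∀ a b c d → (a ℚ.+ b) ℚ.- (c ℚ.+ d) ≡ (a ℚ.- c) ℚ.+ (b ℚ.- d)
    split-+ = solve 4 (λ a b c d → (a :+ b) :- (c :+ d) := (a :- c) :+ (b :- d)) refl
      where open +-*-Solver

    split-* : ∀ a b c d → a ℚ.* b ℚ.- c ℚ.* d ≡ a ℚ.* (b ℚ.- d) ℚ.+ d ℚ.* (a ℚ.- c)
    split-* = solve 4 (λ a b c d → a :* b :- c :* d := a :* (b :- d) :+ d :* (a :- c)) refl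
      where open +-*-Solver

    split-neg : ∀ a b → (ℚ.- a) ℚ.- (ℚ.- b) ≡ ℚ.- (a ℚ.- b)
    split-neg = solve 2 (λ a b → (:- a) :- (:- b) := :- (a :- b)) refl
      where open +-*-Solver

    split-trans : ∀ a b c → a ℚ.- c ≡ (a ℚ.- b) ℚ.+ (b ℚ.- c)
    split-trans = solve 3 (λ a b c → a :- c := (a :- b) :+ (b :- c)) refl
      where open +-*-Solver

    ∣neg-neg∣ : ∀ a b → ℚ.∣ (ℚ.- a) ℚ.- (ℚ.- b) ∣ ≡ ℚ.∣ a ℚ.- b ∣
    ∣neg-neg∣ a b = ≡.trans (cong ℚ.∣_∣ (split-neg a b)) (ℚₚ.∣-p∣≡∣p∣ (a ℚ.- b))

    ⊔≤ˡ : ∀ a b {n} → a ℕ.⊔ b ℕ.≤ n → a ℕ.≤ n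
    ⊔≤ˡ a b = ℕₚ.m⊔n≤o⇒m≤o a b

    ⊔≤ʳ : ∀ a b {n} → a ℕ.⊔ b ℕ.≤ n → b ℕ.≤ n
    ⊔≤ʳ a b = ℕₚ.m⊔n≤o⇒n≤o a b

    +-close : ∀ {ε} a b c d → ℚ.∣ a ℚ.- c ∣ ℚ.< ε ℚ.* ½ → ℚ.∣ b ℚ.- d ∣ ℚ.< ε ℚ.* ½ →
              ℚ.∣ (a ℚ.+ b) ℚ.- (c ℚ.+ d) ∣ ℚ.< ε
    +-close {ε} a b c d p q = subst (λ z → ℚ.∣ z ∣ ℚ.< ε) (≡.sym (split-+ a b c d))
      (+-small (a ℚ.- c) (b ℚ.- d) p q)

    *-close : ∀ {ε A D} (0<A : 0ℚ ℚ.< A) (0<D : 0ℚ ℚ.< D) a b c d →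
              ℚ.∣ a ∣ ℚ.≤ A → ℚ.∣ d ∣ ℚ.≤ D →
              ℚ.∣ a ℚ.- c ∣ ℚ.< div (ε ℚ.* ½) D 0<D → ℚ.∣ b ℚ.- d ∣ ℚ.< div (ε ℚ.* ½) A 0<A →
              ℚ.∣ a ℚ.* b ℚ.- c ℚ.* d ∣ ℚ.< ε
    *-close {ε} 0<A 0<D a b c d a≤A d≤D p q =
      subst (λ z → ℚ.∣ z ∣ ℚ.< ε) (≡.sym (split-* a b c d))
        (+-small (a ℚ.* (b ℚ.- d)) (d ℚ.* (a ℚ.- c))
          (*-small 0<A a (b ℚ.- d) a≤A q) (*-small 0<D d (a ℚ.- c) d≤D p))

    trans-close : ∀ {ε} a b c → ℚ.∣ a ℚ.- b ∣ ℚ.< ε ℚ.* ½ → ℚ.∣ b ℚ.- c ∣ ℚ.< ε ℚ.* ½ →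
                  ℚ.∣ a ℚ.- c ∣ ℚ.< ε
    trans-close {ε} a b c p q = subst (λ z → ℚ.∣ z ∣ ℚ.< ε) (≡.sym (split-trans a b c))
      (+-small (a ℚ.- b) (b ℚ.- c) p q)

  infixl 6 _+_
  infixl 7 _*_
  infix  8 -_

  fromℚ : ℚ → ℝ
  fromℚ q .seq _ = q
  fromℚ q .cauchy ε 0<ε = 0 , λ _ _ _ _ → ∣p-p∣<ε q 0<ε

  0ℝ 1ℝ : ℝ
  0ℝ = fromℚ 0ℚ
  1ℝ = fromℚ 1ℚ

  _+_ : ℝ → ℝ → ℝ
  (x + y) .seq n = seq x n ℚ.+ seq y n
  (x + y) .cauchy ε 0<ε =
    let M , h = cauchy x (ε ℚ.* ½) (half 0<ε)
        N , k = cauchy y (ε ℚ.* ½) (half 0<ε)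
    in M ℕ.⊔ N , λ m n p q →
         +-close (seq x m) (seq y m) (seq x n) (seq y n)
           (h m n (⊔≤ˡ M N p) (⊔≤ˡ M N q)) (k m n (⊔≤ʳ M N p) (⊔≤ʳ M N q))

  -_ : ℝ → ℝ
  (- x) .seq n = ℚ.- seq x n
  (- x) .cauchy ε 0<ε =
    let N , h = cauchy x ε 0<ε
    in N , λ m n p q → subst (ℚ._< ε) (≡.sym (∣neg-neg∣ (seq x m) (seq x n))) (h m n p q)

  _*_ : ℝ → ℝ → ℝ
  (x * y) .seq n = seq x n ℚ.* seq y n
  (x * y) .cauchy ε 0<ε =
    let A , 0<A , K , x≤A = bound (seq x) (cauchy x)
        D , 0<D , L , y≤D = bound (seq y) (cauchy y)
        M , h = cauchy x (div (ε ℚ.* ½) D 0<D) (0<div (half 0<ε) 0<D)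
        N , k = cauchy y (div (ε ℚ.* ½) A 0<A) (0<div (half 0<ε) 0<A)
        KL = K ℕ.⊔ L
        MN = M ℕ.⊔ N
    in KL ℕ.⊔ MN , λ m n p q →
         *-close 0<A 0<D (seq x m) (seq y m) (seq x n) (seq y n)
           (x≤A m (⊔≤ˡ K L (⊔≤ˡ KL MN p)))
           (y≤D n (⊔≤ʳ K L (⊔≤ˡ KL MN q)))
           (h m n (⊔≤ˡ M N (⊔≤ʳ KL MN p)) (⊔≤ˡ M N (⊔≤ʳ KL MN q)))
           (k m n (⊔≤ʳ M N (⊔≤ʳ KL MN p)) (⊔≤ʳ M N (⊔≤ʳ KL MN q)))

  pointwise : ∀ {x y} → (∀ n → seq x n ≡ seq y n) → x ≈ y
  pointwise {x} {y} eq ε 0<ε = 0 , λ n _ →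
    subst (λ z → ℚ.∣ seq x n ℚ.- z ∣ ℚ.< ε) (eq n) (∣p-p∣<ε (seq x n) 0<ε)

  ≈-isEquivalence : IsEquivalence _≈_
  ≈-isEquivalence = record
    { refl  = λ {x} → pointwise {x} {x} (λ _ → refl)
    ; sym   = λ {x} {y} x≈y ε 0<ε → let N , h = x≈y ε 0<ε in
        N , λ n p → subst (ℚ._< ε) (∣-∣-swap (seq x n) (seq y n)) (h n p)
    ; trans = λ {x} {y} {z} x≈y y≈z ε 0<ε →
        let M , h = x≈y (ε ℚ.* ½) (half 0<ε)
            N , k = y≈z (ε ℚ.* ½) (half 0<ε)
        in M ℕ.⊔ N , λ n p →
             trans-close (seq x n) (seq y n) (seq z n) (h n (⊔≤ˡ M N p)) (k n (⊔≤ʳ M N p))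
    }

  +-cong : ∀ {x x′ y y′} → x ≈ x′ → y ≈ y′ → x + y ≈ x′ + y′
  +-cong {x} {x′} {y} {y′} x≈x′ y≈y′ ε 0<ε =
    let M , h = x≈x′ (ε ℚ.* ½) (half 0<ε)
        N , k = y≈y′ (ε ℚ.* ½) (half 0<ε)
    in M ℕ.⊔ N , λ n p →
         +-close (seq x n) (seq y n) (seq x′ n) (seq y′ n) (h n (⊔≤ˡ M N p)) (k n (⊔≤ʳ M N p))

  -‿cong : ∀ {x y} → x ≈ y → - x ≈ - y
  -‿cong {x} {y} x≈y ε 0<ε =
    let N , h = x≈y ε 0<ε
    in N , λ n p → subst (ℚ._< ε) (≡.sym (∣neg-neg∣ (seq x n) (seq y n))) (h n p)

  *-cong : ∀ {x x′ y y′} → x ≈ x′ → y ≈ y′ → x * y ≈ x′ * y′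
  *-cong {x} {x′} {y} {y′} x≈x′ y≈y′ ε 0<ε =
    let A , 0<A , K , x≤A  = bound (seq x) (cauchy x)
        D , 0<D , L , y′≤D = bound (seq y′) (cauchy y′)
        M , h = x≈x′ (div (ε ℚ.* ½) D 0<D) (0<div (half 0<ε) 0<D)
        N , k = y≈y′ (div (ε ℚ.* ½) A 0<A) (0<div (half 0<ε) 0<A)
        KL = K ℕ.⊔ L
        MN = M ℕ.⊔ N
    in KL ℕ.⊔ MN , λ n p →
         *-close 0<A 0<D (seq x n) (seq y n) (seq x′ n) (seq y′ n)
           (x≤A n (⊔≤ˡ K L (⊔≤ˡ KL MN p)))
           (y′≤D n (⊔≤ʳ K L (⊔≤ˡ KL MN p)))
           (h n (⊔≤ˡ M N (⊔≤ʳ KL MN p)))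
           (k n (⊔≤ʳ M N (⊔≤ʳ KL MN p)))

  isCommutativeRing : IsCommutativeRing _≈_ _+_ _*_ -_ 0ℝ 1ℝ
  isCommutativeRing = record
    { isRing = record
      { +-isAbelianGroup = record
        { isGroup = record
          { isMonoid = record
            { isSemigroup = record
              { isMagma = record
                { isEquivalence = ≈-isEquivalence
                ; ∙-cong        = λ {x} {x′} {y} {y′} → +-cong {x} {x′} {y} {y′}
                }
              ; assoc = λ x y z → pointwise {(x + y) + z} {x + (y + z)}
                  λ n → ℚₚ.+-assoc (seq x n) (seq y n) (seq z n)
              }
            ; identity = (λ x → pointwise {0ℝ + x} {x} λ n → ℚₚ.+-identityˡ (seq x n))
                       , (λ x → pointwise {x + 0ℝ} {x} λ n → ℚₚ.+-identityʳ (seq x n))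
            }
          ; inverse = (λ x → pointwise {(- x) + x} {0ℝ} λ n → ℚₚ.+-inverseˡ (seq x n))
                    , (λ x → pointwise {x + (- x)} {0ℝ} λ n → ℚₚ.+-inverseʳ (seq x n))
          ; ⁻¹-cong = λ {x} {y} → -‿cong {x} {y}
          }
        ; comm = λ x y → pointwise {x + y} {y + x} λ n → ℚₚ.+-comm (seq x n) (seq y n)
        }
      ; *-cong     = λ {x} {x′} {y} {y′} → *-cong {x} {x′} {y} {y′}
      ; *-assoc    = λ x y z → pointwise {(x * y) * z} {x * (y * z)}
          λ n → ℚₚ.*-assoc (seq x n) (seq y n) (seq z n)
      ; *-identity = (λ x → pointwise {1ℝ * x} {x} λ n → ℚₚ.*-identityˡ (seq x n))
                   , (λ x → pointwise {x * 1ℝ} {x} λ n → ℚₚ.*-identityʳ (seq x n))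
      ; distrib    = (λ x y z → pointwise {x * (y + z)} {x * y + x * z}
                        λ n → ℚₚ.*-distribˡ-+ (seq x n) (seq y n) (seq z n))
                   , (λ x y z → pointwise {(y + z) * x} {y * x + z * x}
                        λ n → ℚₚ.*-distribʳ-+ (seq x n) (seq y n) (seq z n))
      }
    ; *-comm = λ x y → pointwise {x * y} {y * x} λ n → ℚₚ.*-comm (seq x n) (seq y n)
    }

ℝ-commutativeRing : CommutativeRing 0ℓ 0ℓ
ℝ-commutativeRing = record { isCommutativeRing = Real.isCommutativeRing }

-- R[i] = R[t] / (t² + 1)
module Complexification (R : CommutativeRing 0ℓ 0ℓ) where

  open CommutativeRing R using (Carrier)
  private
    module R = CommutativeRing R

  infixl 6 _+_
  infixl 7 _*_
  infix  8 -_
  infix  4 _≈_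

  record Complex : Set where
    constructor _+i_
    field
      re im : Carrier

  open Complex public

  _≈_ : Complex → Complex → Set
  z ≈ w = (re z R.≈ re w) × (im z R.≈ im w)

  0ℂ 1ℂ : Complex
  0ℂ = R.0# +i R.0#
  1ℂ = R.1# +i R.0#

  _+_ _*_ : Complex → Complex → Complex
  z + w = (re z R.+ re w) +i (im z R.+ im w)
  z * w = (re z R.* re w R.+ R.- (im z R.* im w)) +i (re z R.* im w R.+ im z R.* re w)

  -_ : Complex → Complex
  - z = (R.- re z) +i (R.- im z)

  ≈-setoid : Setoid 0ℓ 0ℓ
  ≈-setoid = record
    { Carrier = Complex
    ; _≈_     = _≈_
    ; isEquivalence = record
      { refl  = R.refl , R.refl
      ; sym   = λ (p , q) → R.sym p , R.sym q
      ; trans = λ (p , q) (p′ , q′) → R.trans p p′ , R.trans q q′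
      }
    }

  +-cong : ∀ {z z′ w w′} → z ≈ z′ → w ≈ w′ → z + w ≈ z′ + w′
  +-cong (p , q) (p′ , q′) = R.+-cong p p′ , R.+-cong q q′

  isCommutativeRing : IsCommutativeRing _≈_ _+_ _*_ -_ 0ℂ 1ℂ
  isCommutativeRing = record
    { isRing = record
      { +-isAbelianGroup = record
        { isGroup = record
          { isMonoid = record
            { isSemigroup = record
              { isMagma = record
                { isEquivalence = Setoid.isEquivalence ≈-setoid
                ; ∙-cong        = +-cong
                }
              ; assoc = λ x y z → R.+-assoc _ _ _ , R.+-assoc _ _ _
              }
            ; identity = (λ x → R.+-identityˡ _ , R.+-identityˡ _)
                       , (λ x → R.+-identityʳ _ , R.+-identityʳ _)
            }
          ; inverse = (λ x → R.-‿inverseˡ _ , R.-‿inverseˡ _)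
                    , (λ x → R.-‿inverseʳ _ , R.-‿inverseʳ _)
          ; ⁻¹-cong = λ (p , q) → R.-‿cong p , R.-‿cong q
          }
        ; comm = λ x y → R.+-comm _ _ , R.+-comm _ _
        }
      ; *-cong = λ (p , q) (p′ , q′) →
            R.+-cong (R.*-cong p p′) (R.-‿cong (R.*-cong q q′))
          , R.+-cong (R.*-cong p q′) (R.*-cong q p′)
      ; *-assoc = *-assoc
      ; *-identity = comm∧idʳ⇒id *-comm *-identityʳ
      ; distrib    = comm∧distrˡ⇒distr +-cong *-comm distribˡ
      }
    ; *-comm = *-comm
    }
    where
    open import Algebra.Consequences.Setoid ≈-setoid
    open import Algebra.Properties.Ring R.ring using (-1*x≈-x)
    open import Algebra.Solver.Ring.NaturalCoefficients.Default R.commutativeSemiring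
      using (solve; _:+_; _:*_; _:=_)
    open import Relation.Binary.Reasoning.Setoid R.setoid

    j : Carrier
    j = R.- R.1#

    -- The solver knows no negation, so it is fed x + j y instead of x − y.
    toj : ∀ x y → x R.+ R.- y R.≈ x R.+ j R.* y
    toj x y = R.+-congˡ (R.sym (-1*x≈-x y))

    *-assoc : ∀ x y z → (x * y) * z ≈ x * (y * z)
    *-assoc (a +i b) (c +i d) (e +i f) = (begin
        (a R.* c R.+ R.- (b R.* d)) R.* e R.+ R.- ((a R.* d R.+ b R.* c) R.* f)
          ≈⟨ toj _ _ ⟩
        (a R.* c R.+ R.- (b R.* d)) R.* e R.+ j R.* ((a R.* d R.+ b R.* c) R.* f)
          ≈⟨ R.+-congʳ (R.*-congʳ (toj _ _)) ⟩
        (a R.* c R.+ j R.* (b R.* d)) R.* e R.+ j R.* ((a R.* d R.+ b R.* c) R.* f)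
          ≈⟨ solve 7 (λ j a b c d e f →
               (a :* c :+ j :* (b :* d)) :* e :+ j :* ((a :* d :+ b :* c) :* f) :=
               a :* (c :* e :+ j :* (d :* f)) :+ j :* (b :* (c :* f :+ d :* e)))
             R.refl j a b c d e f ⟩
        a R.* (c R.* e R.+ j R.* (d R.* f)) R.+ j R.* (b R.* (c R.* f R.+ d R.* e))
          ≈⟨ R.+-congʳ (R.*-congˡ (toj _ _)) ⟨
        a R.* (c R.* e R.+ R.- (d R.* f)) R.+ j R.* (b R.* (c R.* f R.+ d R.* e))
          ≈⟨ toj _ _ ⟨
        a R.* (c R.* e R.+ R.- (d R.* f)) R.+ R.- (b R.* (c R.* f R.+ d R.* e)) ∎)
      , (begin
        (a R.* c R.+ R.- (b R.* d)) R.* f R.+ (a R.* d R.+ b R.* c) R.* e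
          ≈⟨ R.+-congʳ (R.*-congʳ (toj _ _)) ⟩
        (a R.* c R.+ j R.* (b R.* d)) R.* f R.+ (a R.* d R.+ b R.* c) R.* e
          ≈⟨ solve 7 (λ j a b c d e f →
               (a :* c :+ j :* (b :* d)) :* f :+ (a :* d :+ b :* c) :* e :=
               a :* (c :* f :+ d :* e) :+ b :* (c :* e :+ j :* (d :* f)))
             R.refl j a b c d e f ⟩
        a R.* (c R.* f R.+ d R.* e) R.+ b R.* (c R.* e R.+ j R.* (d R.* f))
          ≈⟨ R.+-congˡ (R.*-congˡ (toj _ _)) ⟨
        a R.* (c R.* f R.+ d R.* e) R.+ b R.* (c R.* e R.+ R.- (d R.* f)) ∎)

    *-comm : ∀ x y → x * y ≈ y * x
    *-comm (a +i b) (c +i d) =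
        R.+-cong (R.*-comm a c) (R.-‿cong (R.*-comm b d))
      , R.trans (R.+-comm _ _) (R.+-cong (R.*-comm b c) (R.*-comm a d))

    *-identityʳ : ∀ x → x * 1ℂ ≈ x
    *-identityʳ (a +i b) = (begin
        a R.* R.1# R.+ R.- (b R.* R.0#)
          ≈⟨ R.+-cong (R.*-identityʳ a) (R.trans (R.sym (-1*x≈-x _)) (R.*-congˡ (R.zeroʳ b))) ⟩
        a R.+ j R.* R.0#  ≈⟨ R.+-congˡ (R.zeroʳ j) ⟩
        a R.+ R.0#        ≈⟨ R.+-identityʳ a ⟩
        a ∎)
      , (begin
        a R.* R.0# R.+ b R.* R.1#  ≈⟨ R.+-cong (R.zeroʳ a) (R.*-identityʳ b) ⟩
        R.0# R.+ b                 ≈⟨ R.+-identityˡ b ⟩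
        b ∎)

    distribˡ : ∀ x y z → x * (y + z) ≈ x * y + x * z
    distribˡ (a +i b) (c +i d) (e +i f) = (begin
        a R.* (c R.+ e) R.+ R.- (b R.* (d R.+ f))
          ≈⟨ toj _ _ ⟩
        a R.* (c R.+ e) R.+ j R.* (b R.* (d R.+ f))
          ≈⟨ solve 7 (λ j a b c d e f →
               a :* (c :+ e) :+ j :* (b :* (d :+ f)) :=
               (a :* c :+ j :* (b :* d)) :+ (a :* e :+ j :* (b :* f)))
             R.refl j a b c d e f ⟩
        (a R.* c R.+ j R.* (b R.* d)) R.+ (a R.* e R.+ j R.* (b R.* f))
          ≈⟨ R.+-cong (toj _ _) (toj _ _) ⟨
        (a R.* c R.+ R.- (b R.* d)) R.+ (a R.* e R.+ R.- (b R.* f)) ∎)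
      , solve 6 (λ a b c d e f →
          a :* (d :+ f) :+ b :* (c :+ e) :=
          (a :* d :+ b :* c) :+ (a :* f :+ b :* e)) R.refl a b c d e f

ℂ-commutativeRing : CommutativeRing 0ℓ 0ℓ
ℂ-commutativeRing = record { isCommutativeRing = Complexification.isCommutativeRing ℝ-commutativeRing }

module MultivariatePolynomial (R : CommutativeRing 0ℓ 0ℓ) where

  open CommutativeRing R
  open RawSemiringDefinitions (Semiring.rawSemiring semiring) using (_^_; product)

  Monomial : ℕ → Set
  Monomial n = Vec ℕ n

  degree : ∀ {n} → Monomial n → ℕ
  degree = Vec.sum

  -- A list of terms (coefficient , exponents); a monomial may occur repeatedly, its
  -- coefficients being added up, so polynomials are compared by _≈ₚ_ and never by _≡_.
  Poly : ℕ → Set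
  Poly n = List (Carrier × Monomial n)

  coeff : ∀ {n} → Poly n → Monomial n → Carrier
  coeff p α = foldr (λ (a , β) s → if does (≡-dec ℕₚ._≟_ α β) then a + s else s) 0# p

  infix 4 _≈ₚ_

  _≈ₚ_ : ∀ {n} → Poly n → Poly n → Set
  p ≈ₚ q = ∀ α → coeff p α ≈ coeff q α

  eval : ∀ {n} → Poly n → Vector Carrier n → Carrier
  eval p x = foldr (λ (a , α) s → a * product (λ i → x i ^ Vec.lookup α i) + s) 0# p

  constant : ∀ {n} → Carrier → Poly n
  constant a = (a , Vec.replicate _ 0) ∷ []

  var : ∀ {n} → Fin n → Poly n
  var i = (1# , Vec.replicate _ 0 Vec.[ i ]≔ 1) ∷ []

  polyRawSemiring : ℕ → RawSemiring 0ℓ 0ℓ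
  polyRawSemiring n = record
    { Carrier = Poly n
    ; _≈_     = _≈ₚ_
    ; _+_     = _++_
    ; _*_     = cartesianProductWith λ (a , α) (b , β) → a * b , Vec.zipWith ℕ._+_ α β
    ; 0#      = []
    ; 1#      = constant 1#
    }

  support : ∀ {n} → Poly n → Pred (Monomial n) 0ℓ
  support p α = ¬ coeff p α ≈ 0#

  -- The zero polynomial is homogeneous of every degree.
  Homogeneous : ∀ {n} → ℕ → Poly n → Set
  Homogeneous d p = ∀ α → α ∈ support p → degree α ≡ d

  V : ∀ {n} → Poly n → Pred (Vector Carrier n) 0ℓ
  V f x = eval f x ≈ 0#

module Waring (R : CommutativeRing 0ℓ 0ℓ) where

  open CommutativeRing R using (Carrier; _≈_; _*_; 0#; semiring)
  open RawSemiringDefinitions (Semiring.rawSemiring semiring) using (sum)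
  open MultivariatePolynomial R
  private module Polys {n} = RawSemiring (polyRawSemiring n)
  private module PolyOps {n} = RawSemiringDefinitions (polyRawSemiring n)

  linearForm : ∀ {n} → Vector Carrier n → Poly n
  linearForm a = PolyOps.sum λ i → constant (a i) Polys.* var i

  sumOfPowers : ∀ {n s} → ℕ → (Fin s → Poly n) → Poly n
  sumOfPowers d ℓ = PolyOps.sum λ k → ℓ k PolyOps.^ d

  fermat : ∀ r → ℕ → Poly r
  fermat r d = sumOfPowers d var

  IsMinimum : Pred ℕ 0ℓ → Pred ℕ 0ℓ
  IsMinimum P m = P m × (∀ k → P k → m ℕ.≤ k)

  -- 𝐑(g) = s, for g homogeneous of degree d.
  IsWaringRank : ∀ {n} → ℕ → Poly n → Pred ℕ 0ℓ
  IsWaringRank {n} d g = IsMinimum λ s →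
    Σ[ a ∈ (Fin s → Vector Carrier n) ] (g ≈ₚ sumOfPowers d (λ k → linearForm (a k)))

  -- The monomials x_{i₁} ⋯ x_{i_d} with i₁ < ⋯ < i_d, S being {i₁, …, i_d}.
  Multilinear : ∀ {n} → ℕ → Pred (Monomial n) 0ℓ
  Multilinear {n} d α =
    Σ[ S ∈ Subset n ] (∣ S ∣ ≡ d × α ≡ Vec.map (λ b → if b then 1 else 0) S)

  -- A(n,d) = m.
  IsA : ℕ → ℕ → Pred ℕ 0ℓ
  IsA n d = IsMinimum λ s →
    Σ[ g ∈ Poly n ] (Homogeneous d g × support g ≐ Multilinear d × IsWaringRank d g s)

  -- A combination of the v i with i in S is a coefficient family vanishing off S.
  Span : ∀ {n r} → (Fin n → Vector Carrier r) → Subset n → Pred (Vector Carrier r) 0ℓ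
  Span {n} v S p = Σ[ c ∈ Vector Carrier n ]
    ((∀ i → i ∉ S → c i ≈ 0#) × (∀ k → p k ≈ sum (λ i → c i * v i k)))

ℂ : Set
ℂ = CommutativeRing.Carrier ℂ-commutativeRing

{-# OPTIONS --safe #-}

-- If v₁, …, vₙ are the columns of the matrix whose rows are the linear forms ℓ₁, …, ℓᵣ, then
-- ℓ₁ᵈ + ⋯ + ℓᵣᵈ at c is the Fermat form at ∑ cᵢ vᵢ. So Span v S ⊆ V (fermat r d) says that this
-- polynomial vanishes at the points supported on S, hence has no monomial in the variables S.
-- A monomial of degree d that is not multilinear involves fewer than d variables, and the only
-- multilinear one in d given variables is their product.
module Submission where

open import Defs
open import Algebra.Bundles using (CommutativeRing; RawSemiring; Semiring)
import Algebra.Definitions.RawSemiring as RawSemiringDefinitions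
import Algebra.Properties.CommutativeSemiring.Exp as Exp
import Algebra.Properties.Ring as RingProperties
import Algebra.Properties.Semiring.Mult as Mult
import Algebra.Properties.Semiring.Sum as Sum
open import Data.Bool.Base using (if_then_else_)
open import Data.Empty using (⊥)
open import Data.Fin.Base using (Fin; zero; suc)
import Data.Fin.Properties as Finₚ
open import Data.Fin.Subset as Subset using (Subset; ∣_∣; _∉_; inside; outside)
import Data.Fin.Subset.Properties as Subsetₚ
import Data.Integer.Base as ℤ
open import Data.List.Base using ([]; _∷_; _++_; length; map)
open import Data.List.Relation.Unary.All as All using (All; []; _∷_)
import Data.List.Relation.Unary.All.Properties as Allₚ
open import Data.Nat.Base as ℕ using (ℕ; zero; suc; _≤_; _<_; z≤n; s≤s)
open import Data.Nat.Induction using (<-rec)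
import Data.Nat.Properties as ℕₚ
import Data.Nat.Solver as ℕ-Solver
open import Data.Product.Base using (Σ-syntax; ∃-syntax; _×_; _,_; proj₁; proj₂)
open import Data.Rational.Base as ℚ using (ℚ; 0ℚ; 1ℚ)
import Data.Rational.Properties as ℚₚ
import Data.Rational.Solver as ℚ-Solver
open import Data.Sum.Base using (_⊎_; inj₁; inj₂)
open import Data.Vec.Base as Vec using (Vec; []; _∷_; here; there; lookup)
open import Data.Vec.Functional using (Vector; updateAt)
open import Data.Vec.Functional.Properties using (updateAt-updates; updateAt-minimal)
open import Data.Vec.Properties using (≡-dec)
open import Function.Base using (_∘_)
open import Function.Bundles using (_⇔_; mk⇔)
open import Level using (0ℓ)
open import Relation.Binary.Definitions using (tri<; tri≈; tri>)
open import Relation.Binary.PropositionalEquality as ≡ using (_≡_; _≢_)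
open import Relation.Nullary using (¬_; yes; no; contradiction)
open import Relation.Nullary.Decidable using (decidable-stable)
open import Relation.Unary using (Pred; _∈_; _⊆_; _⊈_; _≐_)

-- Subsets of the variables and exponent vectors.

indicator : ∀ {n} → Subset n → Vec ℕ n
indicator = Vec.map (λ b → if b then 1 else 0)

sum-indicator : ∀ {n} (S : Subset n) → Vec.sum (indicator S) ≡ ∣ S ∣
sum-indicator []            = ≡.refl
sum-indicator (inside  ∷ S) = ≡.cong suc (sum-indicator S)
sum-indicator (outside ∷ S) = sum-indicator S

lookup-indicator-∈ : ∀ {n} {S : Subset n} {i} → i Subset.∈ S → lookup (indicator S) i ≡ 1
lookup-indicator-∈ here        = ≡.refl
lookup-indicator-∈ (there i∈S) = lookup-indicator-∈ i∈S

lookup-indicator-∉ : ∀ {n} {S : Subset n} {i} → i ∉ S → lookup (indicator S) i ≡ 0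
lookup-indicator-∉ {S = outside ∷ S} {zero}  i∉S = ≡.refl
lookup-indicator-∉ {S = inside  ∷ S} {zero}  i∉S = contradiction here i∉S
lookup-indicator-∉ {S = _       ∷ S} {suc i} i∉S = lookup-indicator-∉ (i∉S ∘ there)

indicator-⊆ : ∀ {n} (S T : Subset n) {α} → α ≡ indicator S →
  (∀ i → i ∉ T → lookup α i ≡ 0) → S Subset.⊆ T
indicator-⊆ S T ≡.refl zeros {i} i∈S with i Subsetₚ.∈? T
... | yes i∈T = i∈T
... | no  i∉T = contradiction (≡.trans (≡.sym (lookup-indicator-∈ i∈S)) (zeros i i∉T)) λ ()

⊆∧∣∣≡⇒≡ : ∀ {n} {S T : Subset n} → S Subset.⊆ T → ∣ S ∣ ≡ ∣ T ∣ → S ≡ T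
⊆∧∣∣≡⇒≡ {S = S} {T} S⊆T ∣S∣≡∣T∣ = Subsetₚ.⊆-antisym S⊆T T⊆S
  where
  T⊆S : T Subset.⊆ S
  T⊆S {i} i∈T with i Subsetₚ.∈? S
  ... | yes i∈S = i∈S
  ... | no  i∉S = contradiction ∣S∣≡∣T∣ (ℕₚ.<⇒≢ (Subsetₚ.p⊂q⇒∣p∣<∣q∣ (S⊆T , i , i∈T , i∉S)))

-- Serves to pass from the few variables of a monomial to a set of exactly d - 1 of them, where the
-- vanishing hypothesis applies.
enlarge : ∀ {n} (S : Subset n) {m} → ∣ S ∣ ≤ m → m ≤ n → ∃[ T ] (S Subset.⊆ T × ∣ T ∣ ≡ m)
enlarge []            z≤n        z≤n       = [] , (λ ()) , ≡.refl
enlarge (inside  ∷ S) (s≤s ∣S∣≤m) (s≤s m≤n) with enlarge S ∣S∣≤m m≤n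
... | T , S⊆T , ∣T∣≡m = inside ∷ T , Subsetₚ.s⊆s S⊆T , ≡.cong suc ∣T∣≡m
enlarge {suc n} (outside ∷ S) {m} ∣S∣≤m m≤1+n with m ℕₚ.≤? n
... | yes m≤n = let T , S⊆T , ∣T∣≡m = enlarge S ∣S∣≤m m≤n in outside ∷ T , Subsetₚ.s⊆s S⊆T , ∣T∣≡m
-- Here m = n + 1, so the full set is the only choice.
... | no  m≰n = Subset.⊤ , Subsetₚ.⊆⊤ , ≡.trans (Subsetₚ.∣⊤∣≡n (suc n)) (ℕₚ.≤-antisym (ℕₚ.≰⇒> m≰n) m≤1+n)

positions : ∀ {n} → Vec ℕ n → Subset n
positions = Vec.map λ { zero → outside ; (suc _) → inside }

∉-positions : ∀ {n} (α : Vec ℕ n) {i} → i ∉ positions α → lookup α i ≡ 0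
∉-positions (zero  ∷ α) {zero}  i∉ = ≡.refl
∉-positions (suc _ ∷ α) {zero}  i∉ = contradiction here i∉
∉-positions (_     ∷ α) {suc i} i∉ = ∉-positions α (i∉ ∘ there)

∣positions∣≤sum : ∀ {n} (α : Vec ℕ n) → ∣ positions α ∣ ≤ Vec.sum α
∣positions∣≤sum []          = z≤n
∣positions∣≤sum (zero  ∷ α) = ∣positions∣≤sum α
∣positions∣≤sum (suc a ∷ α) = s≤s (ℕₚ.≤-trans (∣positions∣≤sum α) (ℕₚ.m≤n+m _ a))

-- Each variable present contributes at least 1 to the degree, and an exponent of at least 2 makes
-- the comparison strict. Without such an exponent the monomial is squarefree.
indicator-or-few-positions : ∀ {n} (α : Vec ℕ n) →
  α ≡ indicator (positions α) ⊎ ∣ positions α ∣ < Vec.sum α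
indicator-or-few-positions []                = inj₁ ≡.refl
indicator-or-few-positions (suc (suc a) ∷ α) =
  inj₂ (s≤s (s≤s (ℕₚ.≤-trans (∣positions∣≤sum α) (ℕₚ.m≤n+m _ a))))
indicator-or-few-positions (zero ∷ α) with indicator-or-few-positions α
... | inj₁ α≡ = inj₁ (≡.cong (0 ∷_) α≡)
... | inj₂ few = inj₂ few
indicator-or-few-positions (suc zero ∷ α) with indicator-or-few-positions α
... | inj₁ α≡ = inj₁ (≡.cong (1 ∷_) α≡)
... | inj₂ few = inj₂ (s≤s few)

≢⇒lookup-≢ : ∀ {n} {α β : Vec ℕ n} → α ≢ β → ∃[ i ] lookup α i ≢ lookup β i
≢⇒lookup-≢ {α = []}    {[]}    α≢β = contradiction ≡.refl α≢β
≢⇒lookup-≢ {α = a ∷ α} {b ∷ β} α≢β with a ℕₚ.≟ b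
... | no  a≢b    = zero , a≢b
... | yes ≡.refl = let i , ≢ = ≢⇒lookup-≢ (α≢β ∘ ≡.cong (a ∷_)) in suc i , ≢

sum-replicate-0 : ∀ n → Vec.sum (Vec.replicate n 0) ≡ 0
sum-replicate-0 zero    = ≡.refl
sum-replicate-0 (suc n) = sum-replicate-0 n

sum-unit : ∀ {n} (i : Fin n) → Vec.sum (Vec.replicate n 0 Vec.[ i ]≔ 1) ≡ 1
sum-unit {suc n} zero    = ≡.cong suc (sum-replicate-0 n)
sum-unit         (suc i) = sum-unit i

sum-zipWith-+ : ∀ {n} (α β : Vec ℕ n) → Vec.sum (Vec.zipWith ℕ._+_ α β) ≡ Vec.sum α ℕ.+ Vec.sum β
sum-zipWith-+ []      []      = ≡.refl
sum-zipWith-+ (a ∷ α) (b ∷ β) = ≡.trans (≡.cong (a ℕ.+ b ℕ.+_) (sum-zipWith-+ α β))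
  (solve 4 (λ a b s t → a :+ b :+ (s :+ t) := a :+ s :+ (b :+ t)) ≡.refl a b (Vec.sum α) (Vec.sum β))
  where open ℕ-Solver.+-*-Solver

-- Turns a sum of s powers into one with r ≥ s summands, the filler being the zero linear form.
pad : ∀ {X : Set} {m n} → m ≤ n → (Fin m → X) → X → Fin n → X
pad z≤n       f x _       = x
pad (s≤s m≤n) f x zero    = f zero
pad (s≤s m≤n) f x (suc i) = pad m≤n (f ∘ suc) x i

-- Evaluation of monomials and polynomials.

module Polynomials (R : CommutativeRing 0ℓ 0ℓ) where

  open CommutativeRing R hiding (zero)
  open RawSemiringDefinitions (Semiring.rawSemiring semiring) using (_^_; product; sum)
  open MultivariatePolynomial R
  open Waring R
  open Exp commutativeSemiring using (^-congˡ; ^-homo-*; ^-distrib-*)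
  open Sum semiring using (sum-cong-≋; sum-replicate; sum-replicate-zero; *-distribˡ-sum)
  open Mult semiring using (×-homo-+; ×1-homo-*; ×-assoc-*; ×-congʳ; ×-congˡ) renaming (_×_ to _×ₙ_)
  open RingProperties ring
  open import Algebra.Solver.Ring.NaturalCoefficients.Default commutativeSemiring
    using (solve; _:+_; _:*_; _:=_)
  open import Relation.Binary.Reasoning.Setoid setoid
  private module Polys {n} = RawSemiring (polyRawSemiring n)
  private module PolyOps {n} = RawSemiringDefinitions (polyRawSemiring n)

  _≟_ : ∀ {n} (α β : Monomial n) → _
  _≟_ = ≡-dec ℕₚ._≟_

  monomial : ∀ {n} → Monomial n → Vector Carrier n → Carrier
  monomial α x = product λ i → x i ^ lookup α i

  1^n≈1 : ∀ n → 1# ^ n ≈ 1#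
  1^n≈1 zero    = refl
  1^n≈1 (suc n) = trans (*-identityˡ _) (1^n≈1 n)

  monomial-+ : ∀ {n} (α β : Monomial n) x →
    monomial (Vec.zipWith ℕ._+_ α β) x ≈ monomial α x * monomial β x
  monomial-+ []      []      x = sym (*-identityˡ 1#)
  monomial-+ (a ∷ α) (b ∷ β) x = trans
    (*-cong (^-homo-* (x zero) a b) (monomial-+ α β (x ∘ suc)))
    (solve 4 (λ p q s t → p :* q :* (s :* t) := p :* s :* (q :* t)) refl _ _ _ _)

  monomial-0 : ∀ n x → monomial (Vec.replicate n 0) x ≈ 1#
  monomial-0 zero    x = refl
  monomial-0 (suc n) x = trans (*-identityˡ _) (monomial-0 n (x ∘ suc))

  monomial-unit : ∀ {n} (i : Fin n) x → monomial (Vec.replicate n 0 Vec.[ i ]≔ 1) x ≈ x i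
  monomial-unit {suc n} zero x =
    trans (*-cong (*-identityʳ _) (monomial-0 n (x ∘ suc))) (*-identityʳ _)
  monomial-unit (suc i) x = trans (*-identityˡ _) (monomial-unit i (x ∘ suc))

  monomial-zero : ∀ {n} (α : Monomial n) x i → lookup α i ≢ 0 → x i ≈ 0# → monomial α x ≈ 0#
  monomial-zero (zero  ∷ α) x zero    αᵢ≢0 xᵢ≈0 = contradiction ≡.refl αᵢ≢0
  monomial-zero (suc a ∷ α) x zero    αᵢ≢0 xᵢ≈0 =
    trans (*-congʳ (trans (*-congʳ xᵢ≈0) (zeroˡ _))) (zeroˡ _)
  monomial-zero (a ∷ α)     x (suc i) αᵢ≢0 xᵢ≈0 =
    trans (*-congˡ (monomial-zero α (x ∘ suc) i αᵢ≢0 xᵢ≈0)) (zeroʳ _)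

  monomial-one : ∀ {n} (α : Monomial n) x → (∀ i → lookup α i ≢ 0 → x i ≈ 1#) → monomial α x ≈ 1#
  monomial-one []          x ones = refl
  monomial-one (zero  ∷ α) x ones = trans (*-identityˡ _) (monomial-one α (x ∘ suc) (ones ∘ suc))
  monomial-one (suc a ∷ α) x ones = trans
    (*-cong (trans (^-congˡ (suc a) (ones zero λ ())) (1^n≈1 (suc a)))
            (monomial-one α (x ∘ suc) (ones ∘ suc)))
    (*-identityˡ 1#)

  -- Scaling one variable acts diagonally on monomials; for suitable t the eigenvalues tell apart
  -- monomials that differ in the exponent of xᵢ.
  monomial-scale : ∀ {n} (α : Monomial n) x i t →
    monomial α (updateAt x i (t *_)) ≈ t ^ lookup α i * monomial α x
  monomial-scale (a ∷ α) x zero    t =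
    trans (*-congʳ (^-distrib-* t (x zero) a)) (*-assoc _ _ _)
  monomial-scale (a ∷ α) x (suc i) t = trans
    (*-congˡ (monomial-scale α (x ∘ suc) i t))
    (solve 3 (λ p q s → p :* (q :* s) := q :* (p :* s)) refl _ _ _)

  eval-++ : ∀ {n} (p q : Poly n) x → eval (p ++ q) x ≈ eval p x + eval q x
  eval-++ []            q x = sym (+-identityˡ _)
  eval-++ ((a , α) ∷ p) q x = trans (+-congˡ (eval-++ p q x)) (sym (+-assoc _ _ _))

  eval-* : ∀ {n} (p q : Poly n) x → eval (p Polys.* q) x ≈ eval p x * eval q x
  eval-* []            q x = sym (zeroˡ _)
  eval-* {n} ((a , α) ∷ p) q x = begin
    eval (map (term (a , α)) q ++ (p Polys.* q)) x          ≈⟨ eval-++ (map (term (a , α)) q) _ x ⟩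
    eval (map (term (a , α)) q) x + eval (p Polys.* q) x    ≈⟨ +-cong (eval-map q) (eval-* p q x) ⟩
    a * monomial α x * eval q x + eval p x * eval q x       ≈⟨ distribʳ _ _ _ ⟨
    (a * monomial α x + eval p x) * eval q x                ∎
    where
    term : Carrier × Monomial n → Carrier × Monomial n → Carrier × Monomial n
    term (a , α) (b , β) = a * b , Vec.zipWith ℕ._+_ α β

    eval-map : ∀ q → eval (map (term (a , α)) q) x ≈ a * monomial α x * eval q x
    eval-map []            = sym (zeroʳ _)
    eval-map ((b , β) ∷ q) = trans
      (+-cong (*-congˡ (monomial-+ α β x)) (eval-map q))
      (solve 5 (λ a b s t u → a :* b :* (s :* t) :+ a :* s :* u := a :* s :* (b :* t :+ u))
        refl _ _ _ _ _)

  eval-^ : ∀ {n} (p : Poly n) d x → eval (p PolyOps.^ d) x ≈ eval p x ^ d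
  eval-^ {n} p zero    x = trans (+-identityʳ _) (trans (*-identityˡ _) (monomial-0 n x))
  eval-^     p (suc d) x = trans (eval-* p (p PolyOps.^ d) x) (*-congˡ (eval-^ p d x))

  eval-sum : ∀ {n m} (f : Fin m → Poly n) x → eval (PolyOps.sum f) x ≈ sum (λ k → eval (f k) x)
  eval-sum {m = zero}  f x = refl
  eval-sum {m = suc m} f x = trans (eval-++ (f zero) _ x) (+-congˡ (eval-sum (f ∘ suc) x))

  eval-constant : ∀ {n} a x → eval {n} (constant a) x ≈ a
  eval-constant {n} a x = trans (+-identityʳ _) (trans (*-congˡ (monomial-0 n x)) (*-identityʳ a))

  eval-var : ∀ {n} (i : Fin n) x → eval (var i) x ≈ x i
  eval-var i x = trans (+-identityʳ _) (trans (*-identityˡ _) (monomial-unit i x))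

  eval-linearForm : ∀ {n} (a : Vector Carrier n) x → eval (linearForm a) x ≈ sum (λ i → a i * x i)
  eval-linearForm a x = trans (eval-sum (λ i → constant (a i) Polys.* var i) x) (sum-cong-≋ λ i →
    trans (eval-* (constant (a i)) (var i) x) (*-cong (eval-constant (a i) x) (eval-var i x)))

  eval-sumOfPowers : ∀ {n s} d (ℓ : Fin s → Poly n) x →
    eval (sumOfPowers d ℓ) x ≈ sum (λ k → eval (ℓ k) x ^ d)
  eval-sumOfPowers d ℓ x =
    trans (eval-sum (λ k → ℓ k PolyOps.^ d) x) (sum-cong-≋ λ k → eval-^ (ℓ k) d x)

  eval-fermat : ∀ r d x → eval (fermat r d) x ≈ sum (λ k → x k ^ d)
  eval-fermat r d x = trans (eval-sumOfPowers d var x) (sum-cong-≋ λ k → ^-congˡ d (eval-var k x))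

  -- Homogeneity of sums and products.

  HomogeneousTerms : ∀ {n} → ℕ → Poly n → Set
  HomogeneousTerms d = All λ (_ , α) → degree α ≡ d

  homogeneous-* : ∀ {n d e} {p q : Poly n} →
    HomogeneousTerms d p → HomogeneousTerms e q → HomogeneousTerms (d ℕ.+ e) (p Polys.* q)
  homogeneous-* []                        hq = []
  homogeneous-* {p = (a , α) ∷ _} (≡d ∷ hp) hq = Allₚ.++⁺
    (Allₚ.map⁺ (All.map (λ {(b , β)} ≡e → ≡.trans (sum-zipWith-+ α β) (≡.cong₂ ℕ._+_ ≡d ≡e)) hq))
    (homogeneous-* hp hq)

  homogeneous-^ : ∀ {n} {p : Poly n} → HomogeneousTerms 1 p → ∀ d → HomogeneousTerms d (p PolyOps.^ d)
  homogeneous-^ {n} hp zero    = sum-replicate-0 n ∷ []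
  homogeneous-^     hp (suc d) = homogeneous-* hp (homogeneous-^ hp d)

  homogeneous-sum : ∀ {n m d} {f : Fin m → Poly n} →
    (∀ k → HomogeneousTerms d (f k)) → HomogeneousTerms d (PolyOps.sum f)
  homogeneous-sum {m = zero}  hf = []
  homogeneous-sum {m = suc m} hf = Allₚ.++⁺ (hf zero) (homogeneous-sum (hf ∘ suc))

  homogeneous-linearForm : ∀ {n} (a : Vector Carrier n) → HomogeneousTerms 1 (linearForm a)
  homogeneous-linearForm {n} a = homogeneous-sum λ i →
    homogeneous-* {p = constant (a i)} {q = var i} (sum-replicate-0 n ∷ []) (sum-unit i ∷ [])

  coeff-inhomogeneous : ∀ {n d} {p : Poly n} → HomogeneousTerms d p →
    ∀ α → degree α ≢ d → coeff p α ≈ 0#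
  coeff-inhomogeneous []                               α ≢d = refl
  coeff-inhomogeneous {p = (_ , β) ∷ _} (β≡d ∷ hp) α ≢d with α ≟ β
  ... | yes ≡.refl = contradiction β≡d ≢d
  ... | no  _      = coeff-inhomogeneous hp α ≢d

  -- `HomogeneousTerms` speaks of every listed term and so passes to sums and products; this returns
  -- to `Homogeneous`, using that equality of degrees is decidable.
  support-degree : ∀ {n d} {p : Poly n} → HomogeneousTerms d p →
    ∀ α → α ∈ support p → degree α ≡ d
  support-degree hp α α∈p =
    decidable-stable (degree α ℕₚ.≟ _) λ ≢d → α∈p (coeff-inhomogeneous hp α ≢d)

  -- Collecting the terms of one monomial.

  remove : ∀ {n} → Monomial n → Poly n → Poly n
  remove α []            = []
  remove α ((b , β) ∷ p) with α ≟ β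
  ... | yes _ = remove α p
  ... | no  _ = (b , β) ∷ remove α p

  length-remove : ∀ {n} (α : Monomial n) p → length (remove α p) ≤ length p
  length-remove α []            = z≤n
  length-remove α ((b , β) ∷ p) with α ≟ β
  ... | yes _ = ℕₚ.m≤n⇒m≤1+n (length-remove α p)
  ... | no  _ = s≤s (length-remove α p)

  eval-remove : ∀ {n} (α : Monomial n) p x →
    eval p x ≈ coeff p α * monomial α x + eval (remove α p) x
  eval-remove α []            x = sym (trans (+-identityʳ _) (zeroˡ _))
  eval-remove α ((b , β) ∷ p) x with α ≟ β
  ... | yes ≡.refl = trans (+-congˡ (eval-remove α p x))
    (solve 4 (λ b m c r → b :* m :+ (c :* m :+ r) := (b :+ c) :* m :+ r) refl _ _ _ _)
  ... | no  _ = trans (+-congˡ (eval-remove α p x))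
    (solve 3 (λ t c r → t :+ (c :+ r) := c :+ (t :+ r)) refl _ _ _)

  coeff-remove-≡ : ∀ {n} (α : Monomial n) p → coeff (remove α p) α ≈ 0#
  coeff-remove-≡ α []            = refl
  coeff-remove-≡ α ((b , β) ∷ p) with α ≟ β
  ... | yes _ = coeff-remove-≡ α p
  ... | no α≢β with α ≟ β
  ...   | yes α≡β = contradiction α≡β α≢β
  ...   | no  _   = coeff-remove-≡ α p

  coeff-remove-≢ : ∀ {n} {α γ : Monomial n} p → γ ≢ α → coeff (remove α p) γ ≈ coeff p γ
  coeff-remove-≢             []            γ≢α = refl
  coeff-remove-≢ {α = α} {γ} ((b , β) ∷ p) γ≢α with α ≟ β | γ ≟ β in eq
  ... | yes ≡.refl | yes γ≡α = contradiction γ≡α γ≢α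
  ... | yes ≡.refl | no  _   = coeff-remove-≢ p γ≢α
  ... | no  _      | yes _   rewrite eq = +-congˡ (coeff-remove-≢ p γ≢α)
  ... | no  _      | no  _   rewrite eq = coeff-remove-≢ p γ≢α

  -- The hypothesis concerns collected coefficients, whereas `eval` adds the listed terms one by
  -- one. The induction therefore splits off all terms with the monomial of the first term at once;
  -- `remove` keeps the other coefficients.
  eval-zero : ∀ {n} (p : Poly n) x → (∀ α → coeff p α * monomial α x ≈ 0#) → eval p x ≈ 0#
  eval-zero p x = go (length p) p ℕₚ.≤-refl
    where
    -- `k` bounds the length of the list, since `remove α p` is not a structural part of `p`.
    go : ∀ k p → length p ≤ k → (∀ α → coeff p α * monomial α x ≈ 0#) → eval p x ≈ 0#
    go _       []                ≤k       zeros = refl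
    go (suc k) p@((a , α) ∷ p′) (s≤s ≤k) zeros = begin
      eval p x                                          ≈⟨ eval-remove α p x ⟩
      coeff p α * monomial α x + eval (remove α p) x    ≈⟨ +-cong (zeros α) (go k (remove α p) shorter zeros′) ⟩
      0# + 0#                                           ≈⟨ +-identityˡ 0# ⟩
      0#                                                ∎
      where
      shorter : length (remove α p) ≤ k
      -- Comparing `α` with itself makes `remove` drop the head, so only the tail counts for the
      -- length.
      shorter with α ≟ α
      ... | yes _   = ℕₚ.≤-trans (length-remove α p′) ≤k
      ... | no  α≢α = contradiction ≡.refl α≢α

      zeros′ : ∀ β → coeff (remove α p) β * monomial β x ≈ 0#
      zeros′ β with β ≟ α
      ... | yes ≡.refl = trans (*-congʳ (coeff-remove-≡ α p)) (zeroˡ _)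
      ... | no  β≢α    = trans (*-congʳ (coeff-remove-≢ p β≢α)) (zeros β)

  -- Coordinate subspaces and spans.

  SupportedOn : ∀ {n} → Subset n → Vector Carrier n → Set
  SupportedOn S x = ∀ i → i ∉ S → x i ≈ 0#

  VanishesOn : ∀ {n} → Subset n → Poly n → Set
  VanishesOn S p = ∀ x → SupportedOn S x → eval p x ≈ 0#

  -- Lets the vanishing of f on a coordinate subspace pass to f(..., t xᵢ, ...).
  supportedOn-scale : ∀ {n} {S : Subset n} {x} → SupportedOn S x →
    ∀ i t → SupportedOn S (updateAt x i (t *_))
  supportedOn-scale {x = x} xS i t j j∉S with j Finₚ.≟ i
  ... | yes ≡.refl = trans (reflexive (updateAt-updates i x)) (trans (*-congˡ (xS j j∉S)) (zeroʳ t))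
  ... | no  j≢i    = trans (reflexive (updateAt-minimal j i x j≢i)) (xS j j∉S)

  forms : ∀ {n r} → (Fin n → Vector Carrier r) → Fin r → Poly n
  forms v k = linearForm λ i → v i k

  -- Both sides are ∑ₖ (∑ᵢ cᵢ vᵢₖ)ᵈ. The point `y` is given only up to `≈`, which is what membership
  -- in `Span` provides.
  eval-forms : ∀ {n r} d (v : Fin n → Vector Carrier r) c y →
    (∀ k → y k ≈ sum (λ i → c i * v i k)) →
    eval (sumOfPowers d (forms v)) c ≈ eval (fermat r d) y
  eval-forms {r = r} d v c y y≈ = begin
    eval (sumOfPowers d (forms v)) c       ≈⟨ eval-sumOfPowers d (forms v) c ⟩
    sum (λ k → eval (forms v k) c ^ d)     ≈⟨ sum-cong-≋ (λ k → ^-congˡ d (form k)) ⟩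
    sum (λ k → y k ^ d)                    ≈⟨ eval-fermat r d y ⟨
    eval (fermat r d) y                    ∎
    where
    form : ∀ k → eval (forms v k) c ≈ y k
    form k = trans (eval-linearForm (λ i → v i k) c)
      (trans (sum-cong-≋ λ i → *-comm (v i k) (c i)) (sym (y≈ k)))

  span⊆V⇒vanishesOn : ∀ {n r} d (v : Fin n → Vector Carrier r) S →
    Span v S ⊆ V (fermat r d) → VanishesOn S (sumOfPowers d (forms v))
  span⊆V⇒vanishesOn d v S span⊆ c cS =
    trans (eval-forms d v c _ (λ _ → refl)) (span⊆ (c , cS , λ _ → refl))

  vanishesOn⇒span⊆V : ∀ {n r} d (v : Fin n → Vector Carrier r) S →
    VanishesOn S (sumOfPowers d (forms v)) → Span v S ⊆ V (fermat r d)
  vanishesOn⇒span⊆V d v S vanishes {y} (c , cS , y≈) =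
    trans (sym (eval-forms d v c y y≈)) (vanishes c cS)

  -- Padding a sum of powers with zero forms.

  sum-pad : ∀ {X : Set} {m n} (m≤n : m ≤ n) (f : Fin m → X) x (h : X → Carrier) → h x ≈ 0# →
    sum (λ k → h (pad m≤n f x k)) ≈ sum (h ∘ f)
  sum-pad {n = n} z≤n f x h hx≈0 = trans (sum-cong-≋ {n} λ _ → hx≈0) (sum-replicate-zero n)
  sum-pad (s≤s m≤n) f x h hx≈0 = +-congˡ (sum-pad m≤n (f ∘ suc) x h hx≈0)

  -- For d = 0 this fails, as 0 ^ 0 = 1.
  eval-pad : ∀ {n s r} d (s≤r : s ≤ r) (a : Fin s → Vector Carrier n) x →
    eval (sumOfPowers (suc d) (linearForm ∘ pad s≤r a (λ _ → 0#))) x ≈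
    eval (sumOfPowers (suc d) (linearForm ∘ a)) x
  eval-pad {n} d s≤r a x = begin
    eval (sumOfPowers (suc d) (linearForm ∘ pad s≤r a (λ _ → 0#))) x
      ≈⟨ eval-sumOfPowers (suc d) (linearForm ∘ pad s≤r a (λ _ → 0#)) x ⟩
    sum (λ k → eval (linearForm (pad s≤r a (λ _ → 0#) k)) x ^ suc d)
      ≈⟨ sum-pad s≤r a (λ _ → 0#) (λ b → eval (linearForm b) x ^ suc d) zero-form ⟩
    sum (λ k → eval (linearForm (a k)) x ^ suc d)
      ≈⟨ eval-sumOfPowers (suc d) (linearForm ∘ a) x ⟨
    eval (sumOfPowers (suc d) (linearForm ∘ a)) x ∎
    where
    zero-form : eval (linearForm {n} (λ _ → 0#)) x ^ suc d ≈ 0#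
    zero-form = trans (*-congʳ (trans (eval-linearForm {n} (λ _ → 0#) x)
      (trans (sum-cong-≋ {n} λ i → zeroˡ (x i)) (sum-replicate-zero n)))) (zeroˡ _)

  -- Point configurations and minima.

  Configuration : ℕ → ℕ → ℕ → Set
  Configuration n d r = Σ[ v ∈ (Fin n → Vector Carrier r) ]
    ((∀ (S : Subset n) → suc ∣ S ∣ ≡ d → Span v S ⊆ V (fermat r d)) ×
     (∀ (S : Subset n) → ∣ S ∣ ≡ d → Span v S ⊈ V (fermat r d)))

  -- The minimum of P exists only classically, which is enough as m ≤ r is decidable.
  minimum-≤ : ∀ {P : Pred ℕ 0ℓ} {m r} → P r → (∀ s → IsMinimum P s → m ≤ s) → m ≤ r
  minimum-≤ {P} {m} {r} Pr m≤min = decidable-stable (m ℕₚ.≤? r) λ m≰r → none r (ℕₚ.≰⇒> m≰r) Pr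
    where
    none : ∀ s → s < m → ¬ P s
    none = <-rec _ λ s none-below s<m Ps → ℕₚ.<⇒≱ s<m (m≤min s (Ps , λ k Pk →
      ℕₚ.≮⇒≥ λ k<s → none-below k<s (ℕₚ.<-trans k<s s<m) Pk))

  -- Cancellable elements of a torsion-free ring.

  TorsionFree : Set
  TorsionFree = ∀ n x → suc n ×ₙ x ≈ 0# → x ≈ 0#

  -- Stands in for decidable equality in arguments by contradiction about values of polynomials.
  Stable : Set
  Stable = ∀ x y → ¬ ¬ x ≈ y → x ≈ y

  module TorsionFreeRing (torsionFree : TorsionFree) where

    -- Over a ring not assumed to be a domain, non-zero-divisors replace nonzero elements; they are
    -- closed under products.
    Cancellable : Carrier → Set
    Cancellable a = ∀ y → a * y ≈ 0# → y ≈ 0#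

    cancellable-* : ∀ {a b} → Cancellable a → Cancellable b → Cancellable (a * b)
    cancellable-* ca cb y aby≈0 = cb y (ca _ (trans (sym (*-assoc _ _ _)) aby≈0))

    cancellable-neg : ∀ {a b} → Cancellable (a - b) → Cancellable (b - a)
    cancellable-neg {a} {b} c y eq = c y (begin
      (a - b) * y      ≈⟨ *-congʳ (⁻¹-anti-homo‿- b a) ⟨
      - (b - a) * y    ≈⟨ -‿distribˡ-* (b - a) y ⟨
      - ((b - a) * y)  ≈⟨ -‿cong eq ⟩
      - 0#             ≈⟨ -0#≈0# ⟩
      0#               ∎)

    -- The difference is the positive multiple `suc k` of 1, which torsion-freeness cancels.
    cancellable-< : ∀ {m n} → m < n → Cancellable (n ×ₙ 1# - m ×ₙ 1#)
    cancellable-< {m} {n} m<n y eq with k , ≡.refl ← ℕₚ.m≤n⇒∃[o]m+o≡n m<n =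
      torsionFree k y (begin
        suc k ×ₙ y                              ≈⟨ ×-congʳ (suc k) (*-identityˡ y) ⟨
        suc k ×ₙ (1# * y)                       ≈⟨ ×-assoc-* (suc k) 1# y ⟨
        (suc k ×ₙ 1#) * y                       ≈⟨ *-congʳ (xyx⁻¹≈y (m ×ₙ 1#) _) ⟨
        (m ×ₙ 1# + suc k ×ₙ 1# - m ×ₙ 1#) * y   ≈⟨ *-congʳ (+-congʳ (×-homo-+ 1# m (suc k))) ⟨
        ((m ℕ.+ suc k) ×ₙ 1# - m ×ₙ 1#) * y     ≈⟨ *-congʳ (+-congʳ (×-congˡ (ℕₚ.+-suc m k))) ⟩
        ((suc m ℕ.+ k) ×ₙ 1# - m ×ₙ 1#) * y     ≈⟨ eq ⟩
        0#                                      ∎)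

    2# : Carrier
    2# = 2 ×ₙ 1#

    2^n≈ : ∀ n → 2# ^ n ≈ (2 ℕ.^ n) ×ₙ 1#
    2^n≈ zero    = sym (+-identityʳ 1#)
    2^n≈ (suc n) = trans (*-congˡ (2^n≈ n)) (sym (×1-homo-* 2 (2 ℕ.^ n)))

    -- Powers of 2 with distinct exponents come from distinct natural numbers, so up to sign their
    -- difference is a positive multiple of 1.
    cancellable-2^ : ∀ {m n} → m ≢ n → Cancellable (2# ^ m - 2# ^ n)
    cancellable-2^ {m} {n} m≢n y eq =
      go (trans (*-congʳ (+-cong (sym (2^n≈ m)) (-‿cong (sym (2^n≈ n))))) eq)
      where
      go : ((2 ℕ.^ m) ×ₙ 1# - (2 ℕ.^ n) ×ₙ 1#) * y ≈ 0# → y ≈ 0#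
      go eq′ with ℕₚ.<-cmp m n
      ... | tri< m<n _ _ = cancellable-neg (cancellable-< (ℕₚ.^-monoʳ-< 2 (s≤s (s≤s z≤n)) m<n)) y eq′
      ... | tri≈ _ m≡n _ = contradiction m≡n m≢n
      ... | tri> _ _ n<m = cancellable-< (ℕₚ.^-monoʳ-< 2 (s≤s (s≤s z≤n)) n<m) y eq′

    -- Isolating a coefficient by scaling variables.

    weigh : ∀ {n} → (Monomial n → Carrier) → Poly n → Poly n
    weigh w = map λ (a , β) → w β * a , β

    eval-weigh-1 : ∀ {n} (p : Poly n) x → eval (weigh (λ _ → 1#) p) x ≈ eval p x
    eval-weigh-1 []            x = refl
    eval-weigh-1 ((a , β) ∷ p) x = +-cong (*-congʳ (*-identityˡ a)) (eval-weigh-1 p x)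

    -- Both operations on the right act term by term, so their effect is absorbed into the weights;
    -- this carries vanishing from `w` to the next weight.
    eval-weigh-scale : ∀ {n} (w : Monomial n → Carrier) i e p x →
      eval (weigh (λ γ → w γ * (2# ^ lookup γ i - 2# ^ e)) p) x ≈
      eval (weigh w p) (updateAt x i (2# *_)) + - 2# ^ e * eval (weigh w p) x
    eval-weigh-scale w i e []            x = sym (trans (+-identityˡ _) (zeroʳ _))
    eval-weigh-scale w i e ((a , β) ∷ p) x = begin
      w β * (2# ^ lookup β i - 2# ^ e) * a * monomial β x + eval (weigh _ p) x
        ≈⟨ +-congˡ (eval-weigh-scale w i e p x) ⟩
      w β * (2# ^ lookup β i - 2# ^ e) * a * monomial β x +
        (eval (weigh w p) (updateAt x i (2# *_)) + - 2# ^ e * eval (weigh w p) x)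
        ≈⟨ solve 7 (λ w s t a m p q → w :* (s :+ t) :* a :* m :+ (p :+ t :* q) :=
             (w :* a :* (s :* m) :+ p) :+ t :* (w :* a :* m :+ q)) refl _ _ _ _ _ _ _ ⟩
      (w β * a * (2# ^ lookup β i * monomial β x) + eval (weigh w p) (updateAt x i (2# *_))) +
        - 2# ^ e * (w β * a * monomial β x + eval (weigh w p) x)
        ≈⟨ +-congʳ (+-congʳ (*-congˡ (monomial-scale β x i 2#))) ⟨
      (w β * a * monomial β (updateAt x i (2# *_)) + eval (weigh w p) (updateAt x i (2# *_))) +
        - 2# ^ e * (w β * a * monomial β x + eval (weigh w p) x) ∎

    -- Passing from f to f(…,2xᵢ,…) − 2ᵉf multiplies the coefficient of x^γ by 2^γᵢ − 2ᵉ: it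
    -- kills β when e = βᵢ, while α survives as soon as αᵢ ≠ βᵢ.
    isolate : ∀ {n} {S : Subset n} (p : Poly n) → VanishesOn S p → ∀ α (q : Poly n) →
      ∃[ w ] (VanishesOn S (weigh w p) × Cancellable (w α) ×
              All (λ (_ , β) → α ≢ β → w β ≈ 0#) q)
    isolate p p≈0 α [] =
      (λ _ → 1#) , (λ x xS → trans (eval-weigh-1 p x) (p≈0 x xS))
      , (λ y eq → trans (sym (*-identityˡ y)) eq) , []
    isolate {n} {S} p p≈0 α ((b , β) ∷ q) with isolate p p≈0 α q | α ≟ β
    ... | w , wp≈0 , cancel , kills | yes α≡β = w , wp≈0 , cancel , (λ α≢β → contradiction α≡β α≢β) ∷ kills
    ... | w , wp≈0 , cancel , kills | no  α≢β with i , αᵢ≢βᵢ ← ≢⇒lookup-≢ α≢β =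
      w′ , vanishes , cancellable-* cancel (cancellable-2^ αᵢ≢βᵢ)
      , (λ _ → trans (*-congˡ (-‿inverseʳ _)) (zeroʳ _))
      ∷ All.map (λ kill α≢γ → trans (*-congʳ (kill α≢γ)) (zeroˡ _)) kills
      where
      w′ : Monomial n → Carrier
      w′ γ = w γ * (2# ^ lookup γ i - 2# ^ lookup β i)

      vanishes : VanishesOn S (weigh w′ p)
      vanishes x xS = begin
        eval (weigh w′ p) x
          ≈⟨ eval-weigh-scale w i (lookup β i) p x ⟩
        eval (weigh w p) (updateAt x i (2# *_)) + - 2# ^ lookup β i * eval (weigh w p) x
          ≈⟨ +-cong (wp≈0 _ (supportedOn-scale xS i 2#)) (*-congˡ (wp≈0 x xS)) ⟩
        0# + - 2# ^ lookup β i * 0#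
          ≈⟨ trans (+-identityˡ _) (zeroʳ _) ⟩
        0# ∎

    -- Applied to the terms of `p` itself, `isolate` leaves only those in x^α. At the 0/1 point of
    -- `S`, where x^α = 1 because `α` involves only variables in `S`, their value is
    -- `w α * coeff p α`, and the weight cancels.
    coeff-vanishing : ∀ {n} {S : Subset n} (p : Poly n) → VanishesOn S p →
      ∀ α → (∀ i → i ∉ S → lookup α i ≡ 0) → coeff p α ≈ 0#
    coeff-vanishing {n} {S} p p≈0 α αS with w , wp≈0 , cancel , kills ← isolate p p≈0 α p =
      cancel _ (trans (sym (eval-isolated p kills)) (wp≈0 x xS))
      where
      x : Vector Carrier n
      x i = lookup (indicator S) i ×ₙ 1#

      xS : SupportedOn S x
      xS i i∉S = ×-congˡ (lookup-indicator-∉ i∉S)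

      x^α≈1 : monomial α x ≈ 1#
      x^α≈1 = monomial-one α x one
        where
        one : ∀ i → lookup α i ≢ 0 → x i ≈ 1#
        one i αᵢ≢0 with i Subsetₚ.∈? S
        ... | yes i∈S = trans (×-congˡ (lookup-indicator-∈ i∈S)) (+-identityʳ 1#)
        ... | no  i∉S = contradiction (αS i i∉S) αᵢ≢0

      eval-isolated : ∀ q → All (λ (_ , β) → α ≢ β → w β ≈ 0#) q →
        eval (weigh w q) x ≈ w α * coeff q α
      eval-isolated []            []             = sym (zeroʳ _)
      eval-isolated ((b , β) ∷ q) (kill ∷ kills) with α ≟ β
      ... | yes ≡.refl = trans
        (+-cong (trans (*-congˡ x^α≈1) (*-identityʳ _)) (eval-isolated q kills))
        (sym (distribˡ _ _ _))
      ... | no  α≢β = trans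
        (+-cong (trans (*-congʳ (trans (*-congʳ (kill α≢β)) (zeroˡ _))) (zeroˡ _))
                (eval-isolated q kills))
        (+-identityˡ _)

    -- Multilinear support and vanishing on coordinate subspaces.

    multilinear⇒¬vanishesOn : ∀ {n d} (p : Poly n) → Multilinear d ⊆ support p →
      ∀ S → ∣ S ∣ ≡ d → ¬ VanishesOn S p
    multilinear⇒¬vanishesOn p nonzero S ∣S∣≡d p≈0 =
      nonzero (S , ∣S∣≡d , ≡.refl) (coeff-vanishing p p≈0 (indicator S) λ i → lookup-indicator-∉)

    module _ (stable : Stable) where

      -- As ≈ is stable, it suffices to refute a term that is nonzero at a point supported on S.
      vanishesOn : ∀ {n} {S : Subset n} (p : Poly n) →
        (∀ α → α ∈ support p → (∀ i → i ∉ S → lookup α i ≡ 0) → ⊥) → VanishesOn S p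
      vanishesOn {S = S} p none x xS = eval-zero p x λ α → stable _ _ λ ≉0 →
        none α (λ ≈0 → ≉0 (trans (*-congʳ ≈0) (zeroˡ _))) λ i i∉S →
          decidable-stable (lookup α i ℕₚ.≟ 0) λ αᵢ≢0 →
            ≉0 (trans (*-congˡ (monomial-zero α x i αᵢ≢0 (xS i i∉S))) (zeroʳ _))

      -- A multilinear monomial of degree d involves d variables, too many for a set of d - 1.
      multilinear⇒vanishesOn : ∀ {n d} (p : Poly n) → support p ⊆ Multilinear d →
        ∀ S → suc ∣ S ∣ ≡ d → VanishesOn S p
      multilinear⇒vanishesOn p multilinear S ≡.refl = vanishesOn p λ α α∈p αS →
        let T , ∣T∣≡1+∣S∣ , α≡T = multilinear {α} α∈p
        in ℕₚ.1+n≰n (≡.subst (_≤ ∣ S ∣) ∣T∣≡1+∣S∣ (Subsetₚ.p⊆q⇒∣p∣≤∣q∣ (indicator-⊆ T S α≡T αS)))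

      module _ {n d} (d≤n : d ≤ n) {p : Poly n} (hp : HomogeneousTerms d p)
               (vanishes : ∀ S → suc ∣ S ∣ ≡ d → VanishesOn S p) where

        -- If some exponent exceeds 1, fewer than d variables occur. They lie in a set of d - 1
        -- indices on which `p` vanishes, so the coefficient is 0 by `coeff-vanishing`.
        support-indicator : ∀ α → α ∈ support p → α ≡ indicator (positions α)
        support-indicator α α∈p with indicator-or-few-positions α
        ... | inj₁ α≡  = α≡
        ... | inj₂ few
          -- Here m = `∣ positions α ∣ + o` equals d - 1, the size to which the set is enlarged; d ≤
          -- n leaves room for it.
          with o , 1+m≡d ← ℕₚ.m≤n⇒∃[o]m+o≡n
                 (≡.subst (∣ positions α ∣ <_) (support-degree hp α α∈p) few)
          with S , ⊆S , ∣S∣≡m ← enlarge (positions α) (ℕₚ.m≤m+n _ o)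
                 (ℕₚ.<⇒≤ (≡.subst (_≤ n) (≡.sym 1+m≡d) d≤n)) =
          contradiction
            (coeff-vanishing p (vanishes S (≡.trans (≡.cong suc ∣S∣≡m) 1+m≡d)) α λ i i∉S →
              ∉-positions α (i∉S ∘ ⊆S))
            α∈p

        vanishesOn⇒multilinear : support p ⊆ Multilinear d
        vanishesOn⇒multilinear {α} α∈p = positions α , ∣positions∣≡d , support-indicator α α∈p
          where
          ∣positions∣≡d : ∣ positions α ∣ ≡ d
          ∣positions∣≡d = ≡.trans (≡.sym (sum-indicator (positions α)))
            (≡.trans (≡.cong degree (≡.sym (support-indicator α α∈p))) (support-degree hp α α∈p))

        -- Were the coefficient of the product over `S` zero, `p` would vanish on `S`: a monomial of
        -- the support in the variables of `S` is the product over some `T` of size d inside `S`,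
        -- hence over `S` itself.
        ¬vanishesOn⇒multilinear : (∀ S → ∣ S ∣ ≡ d → ¬ VanishesOn S p) → Multilinear d ⊆ support p
        ¬vanishesOn⇒multilinear ¬vanishes (S , ∣S∣≡d , ≡.refl) ≈0 =
          ¬vanishes S ∣S∣≡d (vanishesOn p λ α α∈p αS →
            let T , ∣T∣≡d , α≡T = vanishesOn⇒multilinear {α} α∈p
                T≡S = ⊆∧∣∣≡⇒≡ (indicator-⊆ T S α≡T αS) (≡.trans ∣T∣≡d (≡.sym ∣S∣≡d))
            in α∈p (trans (reflexive (≡.cong (coeff p) (≡.trans α≡T (≡.cong indicator T≡S)))) ≈0))

      -- From A(n,d) to configurations and back.

      ≤⇒configuration : ∀ n d r A → IsA n d A → A ≤ r → Configuration n d r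
      -- Degree 0 is separate because 0 ^ 0 = 1 rules out padding. All points are 0, and the Fermat
      -- form is the constant r, to be shown nonzero.
      ≤⇒configuration n zero r A ((g , _ , (_ , g⊇) , (a , g≈) , _) , _) A≤r =
        (λ _ _ → 0#) , (λ _ ()) , λ S _ span⊆ → 1≉0 (1≈0 A≤r a g≈ (span⊆ (origin S)))
        where
        0∈g : indicator Subset.⊥ ∈ support g
        0∈g = g⊇ (Subset.⊥ , Subsetₚ.∣⊥∣≡0 n , ≡.refl)

        1≉0 : ¬ 1# ≈ 0#
        1≉0 1≈0 = 0∈g (trans (sym (*-identityˡ _)) (trans (*-congʳ 1≈0) (zeroˡ _)))

        origin : ∀ S → Span {n} {r} (λ _ _ → 0#) S (λ _ → 0#)
        origin S = (λ _ → 0#) , (λ _ _ → refl) , λ _ →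
          sym (trans (sum-cong-≋ {n} λ _ → zeroˡ 0#) (sum-replicate-zero n))

        1≈0 : ∀ {A r} → A ≤ r → (a : Fin A → Vector Carrier n) →
          g ≈ₚ sumOfPowers 0 (linearForm ∘ a) → V (fermat r 0) (λ _ → 0#) → 1# ≈ 0#
        -- With no summands `g` would be 0, against its nonzero constant term; so r is positive.
        1≈0 z≤n           a g≈0 _   = contradiction (g≈0 (indicator Subset.⊥)) 0∈g
        -- The Fermat form has the value `suc r` times 1, and torsion-freeness reduces its vanishing
        -- to 1 = 0.
        1≈0 {r = suc r} _ a _   r≈0 = torsionFree r 1#
          (trans (sym (trans (eval-fermat (suc r) 0 (λ _ → 0#)) (sum-replicate (suc r)))) r≈0)

      ≤⇒configuration n (suc d) r A ((g , _ , (g⊆ , g⊇) , (a , g≈) , _) , _) A≤r =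
        v
        , (λ S ∣S∣≡d → vanishesOn⇒span⊆V (suc d) v S λ c cS →
             trans (eval-pad d A≤r a c) (multilinear⇒vanishesOn Q Q⊆ S ∣S∣≡d c cS))
        , (λ S ∣S∣≡d span⊆ → multilinear⇒¬vanishesOn Q Q⊇ S ∣S∣≡d λ c cS →
             trans (sym (eval-pad d A≤r a c)) (span⊆V⇒vanishesOn (suc d) v S span⊆ c cS))
        where
        -- Entry k of `v i` is the coefficient of xᵢ in the k-th form; the forms beyond the first A
        -- are zero.
        v : Fin n → Vector Carrier r
        v i k = pad A≤r a (λ _ → 0#) k i

        -- `Q` replaces `g`: spans are linked with sums of powers, and equal coefficients give `Q`
        -- the support of `g`.
        Q : Poly n
        Q = sumOfPowers (suc d) (linearForm ∘ a)

        Q⊆ : support Q ⊆ Multilinear (suc d)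
        Q⊆ {α} α∈Q = g⊆ λ ≈0 → α∈Q (trans (sym (g≈ α)) ≈0)

        Q⊇ : Multilinear (suc d) ⊆ support Q
        Q⊇ {α} α-multilinear ≈0 = g⊇ α-multilinear (trans (g≈ α) ≈0)

      configuration⇒≤ : ∀ n d r A → IsA n d A → Configuration n d r → A ≤ r
      configuration⇒≤ n d r A (_ , A-min) (v , span⊆ , span⊈) with d ℕₚ.≤? n
      -- `Q` is by construction a sum of r powers, so any rank of it is at most r; as `Q` competes
      -- in the definition of A, that rank is at least A.
      ... | yes d≤n = minimum-≤ ((λ k i → v i k) , λ _ → refl) λ s rank →
        A-min s (Q , homogeneous , (Q⊆ , Q⊇) , rank)
        where
        Q : Poly n
        Q = sumOfPowers d (forms v)

        hQ : HomogeneousTerms d Q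
        hQ = homogeneous-sum λ k → homogeneous-^ (homogeneous-linearForm (λ i → v i k)) d

        vanishes : ∀ S → suc ∣ S ∣ ≡ d → VanishesOn S Q
        vanishes S ∣S∣≡d = span⊆V⇒vanishesOn d v S (span⊆ S ∣S∣≡d)

        Q⊆ : support Q ⊆ Multilinear d
        Q⊆ = vanishesOn⇒multilinear d≤n hQ vanishes

        Q⊇ : Multilinear d ⊆ support Q
        Q⊇ = ¬vanishesOn⇒multilinear d≤n hQ vanishes λ S ∣S∣≡d Q≈0 →
          span⊈ S ∣S∣≡d (vanishesOn⇒span⊆V d v S Q≈0)

        homogeneous : Homogeneous d Q
        homogeneous = support-degree hQ
      -- For d > n there is no multilinear monomial, so the zero polynomial, of rank 0, competes and
      -- A = 0.
      ... | no  d≰n = ℕₚ.≤-trans (A-min 0 zero-poly) z≤n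
        where
        zero-poly : Σ[ g ∈ Poly n ] (Homogeneous d g × support g ≐ Multilinear d × IsWaringRank d g 0)
        zero-poly = []
          , (λ _ α∈ → contradiction refl α∈)
          , ((λ α∈ → contradiction refl α∈)
            , λ (S , ∣S∣≡d , _) → contradiction (≡.subst (_≤ n) ∣S∣≡d (Subsetₚ.∣p∣≤n S)) d≰n)
          , ((λ ()) , λ _ → refl) , λ _ _ → z≤n

-- Torsion-freeness and stability of the real numbers.

module _ where
  open Real using (ℝ; seq; cauchy)
  private module R = CommutativeRing ℝ-commutativeRing
  open Mult R.semiring using () renaming (_×_ to _×ₙ_)

  multiple : ∀ n x k → ∃[ t ] (0ℚ ℚ.≤ t × seq (n ×ₙ x) k ≡ t ℚ.* seq x k)
  multiple zero    x k = 0ℚ , ℚₚ.≤-refl , ≡.sym (ℚₚ.*-zeroˡ (seq x k))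
  multiple (suc n) x k with t , 0≤t , eq ← multiple n x k =
    1ℚ ℚ.+ t , ℚₚ.+-mono-≤ (ℚₚ.<⇒≤ (ℚₚ.positive⁻¹ 1ℚ)) 0≤t
    , ≡.trans (≡.cong (seq x k ℚ.+_) eq)
        (≡.trans (≡.cong (ℚ._+ t ℚ.* seq x k) (≡.sym (ℚₚ.*-identityˡ (seq x k))))
          (≡.sym (ℚₚ.*-distribʳ-+ (seq x k) 1ℚ t)))

  -- The entry of the multiple is that of `x` times 1 + t with t ≥ 0.
  ∣∣≤∣multiple∣ : ∀ n x k → ℚ.∣ seq x k ∣ ℚ.≤ ℚ.∣ seq (suc n ×ₙ x) k ∣
  ∣∣≤∣multiple∣ n x k with t , 0≤t , eq ← multiple n x k = begin
    ℚ.∣ q ∣                    ≡⟨ ℚₚ.*-identityˡ ℚ.∣ q ∣ ⟨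
    1ℚ ℚ.* ℚ.∣ q ∣             ≤⟨ ℚₚ.*-monoʳ-≤-nonNeg ℚ.∣ q ∣ {{ℚₚ.∣-∣-nonNeg q}} 1≤1+t ⟩
    (1ℚ ℚ.+ t) ℚ.* ℚ.∣ q ∣     ≡⟨ ≡.cong (ℚ._* ℚ.∣ q ∣) (ℚₚ.0≤p⇒∣p∣≡p 0≤1+t) ⟨
    ℚ.∣ 1ℚ ℚ.+ t ∣ ℚ.* ℚ.∣ q ∣ ≡⟨ ℚₚ.∣p*q∣≡∣p∣*∣q∣ (1ℚ ℚ.+ t) q ⟨
    ℚ.∣ (1ℚ ℚ.+ t) ℚ.* q ∣     ≡⟨ ≡.cong ℚ.∣_∣ (ℚₚ.*-distribʳ-+ q 1ℚ t) ⟩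
    ℚ.∣ 1ℚ ℚ.* q ℚ.+ t ℚ.* q ∣ ≡⟨ ≡.cong₂ (λ u w → ℚ.∣ u ℚ.+ w ∣) (ℚₚ.*-identityˡ q) (≡.sym eq) ⟩
    ℚ.∣ q ℚ.+ seq (n ×ₙ x) k ∣ ∎
    where
    open ℚₚ.≤-Reasoning
    q = seq x k

    1≤1+t : 1ℚ ℚ.≤ 1ℚ ℚ.+ t
    1≤1+t = ℚₚ.+-monoʳ-≤ 1ℚ 0≤t

    0≤1+t : 0ℚ ℚ.≤ 1ℚ ℚ.+ t
    0≤1+t = ℚₚ.≤-trans (ℚₚ.<⇒≤ (ℚₚ.positive⁻¹ 1ℚ)) 1≤1+t

  p-0≡p : ∀ p → p ℚ.- 0ℚ ≡ p
  p-0≡p = ℚₚ.+-identityʳ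

  -- Entries of `x` are bounded by those of its multiple, so the index at which the multiple becomes
  -- small serves for `x` too.
  ℝ-torsionFree : Polynomials.TorsionFree ℝ-commutativeRing
  ℝ-torsionFree n x nx≈0 ε 0<ε = let N , h = nx≈0 ε 0<ε in N , λ k N≤k → ℚₚ.≤-<-trans
    (≡.subst₂ (λ p q → ℚ.∣ p ∣ ℚ.≤ ℚ.∣ q ∣) (≡.sym (p-0≡p _)) (≡.sym (p-0≡p _)) (∣∣≤∣multiple∣ n x k))
    (h k N≤k)

  -- An index cannot be extracted from a doubly negated convergence, so it is taken from the Cauchy
  -- modulus of x - y. The hypothesis only proves a decidable inequality between rationals.
  ℝ-stable : Polynomials.Stable ℝ-commutativeRing
  ℝ-stable x y ¬¬x≈y ε 0<ε = N , close
    where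
    ⅓ : ℚ
    ⅓ = ℤ.+ 1 ℚ./ 3

    -- One third of ε covers the distance from `seq z n` to `seq z N`, two thirds bound `seq z N`.
    δ : ℚ
    δ = ε ℚ.* ⅓

    0<δ : 0ℚ ℚ.< δ
    0<δ = ≡.subst (ℚ._< δ) (ℚₚ.*-zeroˡ ⅓) (ℚₚ.*-monoˡ-<-pos ⅓ 0<ε)

    3δ≡ε : δ ℚ.+ (δ ℚ.+ δ) ≡ ε
    3δ≡ε = ≡.trans
      (solve 2 (λ e t → e :* t :+ (e :* t :+ e :* t) := e :* (t :+ (t :+ t))) ≡.refl ε ⅓)
      (ℚₚ.*-identityʳ ε)
      where open ℚ-Solver.+-*-Solver

    z : ℝ
    z = x Real.+ Real.- y

    N : ℕ
    N = proj₁ (cauchy z δ 0<δ)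

    near : ∀ m n → N ≤ m → N ≤ n → ℚ.∣ seq z m ℚ.- seq z n ∣ ℚ.< δ
    near = proj₂ (cauchy z δ 0<δ)

    ∣p∣≤ : ∀ p q → ℚ.∣ p ∣ ℚ.≤ ℚ.∣ p ℚ.- q ∣ ℚ.+ ℚ.∣ q ∣
    ∣p∣≤ p q = ≡.subst (λ u → ℚ.∣ u ∣ ℚ.≤ ℚ.∣ p ℚ.- q ∣ ℚ.+ ℚ.∣ q ∣)
      (solve 2 (λ p q → p :- q :+ q := p) ≡.refl p q) (ℚₚ.∣p+q∣≤∣p∣+∣q∣ (p ℚ.- q) q)
      where open ℚ-Solver.+-*-Solver

    z-small : ℚ.∣ seq z N ∣ ℚ.< δ ℚ.+ δ
    z-small = decidable-stable (_ ℚₚ.<? _) λ large → ¬¬x≈y λ x≈y →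
      let M , h = x≈y δ 0<δ
          -- Beyond `M` the entries are small by convergence, beyond `N` they are near `seq z N`.
          k = M ℕ.⊔ N
      in large (ℚₚ.≤-<-trans (∣p∣≤ (seq z N) (seq z k))
           (ℚₚ.+-mono-< (near N k ℕₚ.≤-refl (ℕₚ.m≤n⊔m M N)) (h k (ℕₚ.m≤m⊔n M N))))

    close : ∀ n → N ≤ n → ℚ.∣ seq z n ∣ ℚ.< ε
    close n N≤n = ≡.subst (ℚ.∣ seq z n ∣ ℚ.<_) 3δ≡ε
      (ℚₚ.≤-<-trans (∣p∣≤ (seq z n) (seq z N)) (ℚₚ.+-mono-< (near n N N≤n ℕₚ.≤-refl) z-small))

-- Torsion-freeness and stability of the complex numbers.

module _ where
  open Complexification ℝ-commutativeRing using (Complex; re; im)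
  private
    module R = CommutativeRing ℝ-commutativeRing
    module C = CommutativeRing ℂ-commutativeRing
    module ℝ× = Mult R.semiring
    module ℂ× = Mult C.semiring

  re-× : ∀ n z → re (n ℂ×.× z) ≡ n ℝ×.× re z
  re-× zero    z = ≡.refl
  re-× (suc n) z = ≡.cong (re z R.+_) (re-× n z)

  im-× : ∀ n z → im (n ℂ×.× z) ≡ n ℝ×.× im z
  im-× zero    z = ≡.refl
  im-× (suc n) z = ≡.cong (im z R.+_) (im-× n z)

  ℂ-torsionFree : Polynomials.TorsionFree ℂ-commutativeRing
  ℂ-torsionFree n z (re≈0 , im≈0) =
      ℝ-torsionFree n (re z) (≡.subst (R._≈ R.0#) (re-× (suc n) z) re≈0)
    , ℝ-torsionFree n (im z) (≡.subst (R._≈ R.0#) (im-× (suc n) z) im≈0)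

  ℂ-stable : Polynomials.Stable ℂ-commutativeRing
  ℂ-stable z w ¬¬z≈w =
      ℝ-stable (re z) (re w) (λ ¬re → ¬¬z≈w (¬re ∘ proj₁))
    , ℝ-stable (im z) (im w) (λ ¬im → ¬¬z≈w (¬im ∘ proj₂))

open MultivariatePolynomial ℂ-commutativeRing using (V)
open Waring ℂ-commutativeRing using (IsA; Span; fermat)

proposition30 : ∀ (n d r A : ℕ) → IsA n d A →
    A ≤ r ⇔
    (Σ[ v ∈ (Fin n → Vector ℂ r) ]
    ((∀ (S : Subset n) → suc ∣ S ∣ ≡ d → Span v S ⊆ V (fermat r d)) ×
    (∀ (S : Subset n) → ∣ S ∣ ≡ d → Span v S ⊈ V (fermat r d))))
proposition30 n d r A isA = mk⇔
  (≤⇒configuration ℂ-stable n d r A isA) (configuration⇒≤ ℂ-stable n d r A isA)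
  where open Polynomials.TorsionFreeRing ℂ-commutativeRing ℂ-torsionFree
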